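{- Let $s\ge 1$ and $k\ge 2$ be integers, and let $T$ be a tree in which one vertex has degree $k$ and every other vertex has degree at most $\lceil k/2\rceil$. Then $$br_{\Delta}(T;s)=s(k-1)+1.$$
   Context: For graphs $H$ and $G$ and a positive integer $s$, write $H\xrightarrow{s} G$ if every coloring of the edges of $H$ with $s$ colors contains a monochromatic subgraph isomorphic to $G$. The degree bipartite Ramsey number is $br_{\Delta}(G;s)=\min\{\Delta(H): H \text{ is bipartite and } H\xrightarrow{s} G\}$, where $\Delta(H)$ denotes the maximum degree of $H$. -}

module Defs where

open import Data.Bool using (Bool)
open import Data.Fin using (Fin)
open import Data.Fin.Subset using (Subset; ∣_∣)
open import Data.List using (List; _∷_; _∷ʳ_; map; allFin)
open import Data.List.Extrema.Nat using (max)
open import Data.List.Relation.Unary.Linked using (Linked)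
open import Data.List.Relation.Unary.Unique.Propositional using (Unique)
open import Data.Nat using (ℕ; _≤_)
open import Data.Product using (Σ-syntax; ∃-syntax; _×_)
open import Data.Vec using (tabulate)
open import Function.Bundles using (_⇔_)
open import Function.Definitions using (Injective)
open import Level using (Level; 0ℓ)
open import Relation.Binary using (Rel; Decidable; Symmetric; Irreflexive)
open import Relation.Binary.Construct.Closure.ReflexiveTransitive using (Star)
open import Relation.Binary.PropositionalEquality using (_≡_; _≢_)
open import Relation.Nullary using (¬_; does)
open import Relation.Unary using (Pred; _∈_)

record Graph : Set₁ where
  field
    order : ℕ

  Vertex : Set
  Vertex = Fin order

  field
    _~_    : Rel Vertex 0ℓ
    _~?_   : Decidable _~_
    ~-sym  : Symmetric _~_
    ~-irrefl : Irreflexive _≡_ _~_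

  neighbours : Vertex → Subset order
  neighbours v = tabulate (λ w → does (v ~? w))

  degree : Vertex → ℕ
  degree v = ∣ neighbours v ∣

  -- The default value 0 only matters for the graph with no vertices.
  Δ : ℕ
  Δ = max 0 (map degree (allFin order))

  Bipartite : Set
  Bipartite = Σ[ side ∈ (Vertex → Bool) ] (∀ {u v} → u ~ v → side u ≢ side v)

  Connected : Set
  Connected = Vertex × (∀ u v → Star _~_ u v)

  -- A cycle is given by its list of at least three distinct vertices, in
  -- cyclic order.
  Acyclic : Set
  Acyclic = ∀ u v w (xs : List Vertex) → let vs = u ∷ v ∷ w ∷ xs in
            ¬ (Unique vs × Linked _~_ (vs ∷ʳ u))

  IsTree : Set
  IsTree = Connected × Acyclic

open Graph using (Vertex; degree; Δ; Bipartite; IsTree) public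

-- Since the two proofs in colour-unordered are arbitrary, it also makes the
-- colour of u ~ v independent of the proof of adjacency.
record EdgeColouring (H : Graph) (s : ℕ) : Set where
  open Graph H using (_~_)
  field
    colour           : ∀ {u v} → u ~ v → Fin s
    colour-unordered : ∀ {u v} (e : u ~ v) (e′ : v ~ u) → colour e ≡ colour e′

-- Subgraphs are not required to be induced.
record Subgraph (H : Graph) : Set₁ where
  open Graph H using (_~_)
  field
    V       : Pred (Vertex H) 0ℓ
    E       : Rel (Vertex H) 0ℓ
    E-sym   : Symmetric E
    E⇒~     : ∀ {u v} → E u v → u ~ v
    E⇒V     : ∀ {u v} → E u v → u ∈ V

record _≅_ (G : Graph) {H : Graph} (S : Subgraph H) : Set where
  open Graph G using (_~_)
  open Subgraph S
  field
    to         : Vertex G → Vertex H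
    injective  : Injective _≡_ _≡_ to
    to-∈       : ∀ x → to x ∈ V
    surjective : ∀ {v} → v ∈ V → ∃[ x ] to x ≡ v
    adjacency  : ∀ x y → x ~ y ⇔ E (to x) (to y)

Monochromatic : ∀ {H s} → EdgeColouring H s → Subgraph H → Set
Monochromatic {s = s} c S =
  Σ[ i ∈ Fin s ] (∀ {u v} (e : E u v) → colour (E⇒~ e) ≡ i)
  where
  open EdgeColouring c
  open Subgraph S

_⟶[_]_ : Graph → ℕ → Graph → Set₁
H ⟶[ s ] G = (c : EdgeColouring H s) →
             Σ[ S ∈ Subgraph H ] (Monochromatic c S × G ≅ S)

IsMinimum : ∀ {ℓ : Level} → Pred ℕ ℓ → ℕ → Set ℓ
IsMinimum P m = m ∈ P × (∀ {d} → d ∈ P → m ≤ d)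

-- The degree bipartite Ramsey number of G for s colours exists and equals m.
IsDegreeBipartiteRamseyNumber : Graph → ℕ → ℕ → Set₁
IsDegreeBipartiteRamseyNumber G s m =
  IsMinimum (λ d → Σ[ H ∈ Graph ] (Bipartite H × H ⟶[ s ] G × Δ H ≡ d)) m

{-# OPTIONS --safe #-}

-- Lower bound: by König's edge colouring theorem a bipartite graph of maximum
-- degree at most s(k-1) has a proper colouring with s(k-1) colours; grouping
-- these into s classes of k-1 leaves no monochromatic star with k leaves.
--
-- Upper bound: let d = s(k-1)+1 and take a bipartite d-regular graph that
-- looks like the d-regular tree up to distance |V(T)|.  In any s-colouring some
-- colour class has average degree above k-1.  Repeatedly deleting vertices of
-- degree at most (k-1)/2 keeps the average above k-1, so it ends in a nonempty
-- core with all degrees at least ⌈k/2⌉ and some degree at least k.  Then T is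
-- embedded greedily, its root at a vertex of degree at least k; the tree-like
-- neighbourhood of the root makes the embedding injective.
--
-- The regular graph is the Schreier graph of d involutions σ i on the self-maps
-- of a finite set of words: σ i composes with the operation that prepends the
-- letter i, or cancels it.  Only its part on the surjective maps is d-regular and
-- tree-like, and the averaging is done there.

module Submission where

open import Data.Bool using (Bool; true; false; not; if_then_else_)
import Data.Bool.Properties as Bool
open import Data.Empty using (⊥; ⊥-elim)
open import Data.Fin using (Fin; zero; suc; quotient; remainder; combine; funToFin; finToFun)
open import Data.Fin.Permutation.Components using (transpose; transpose-inverse)
import Data.Fin.Properties as Fin
open import Data.Fin.Subset using (∣_∣) renaming (_∈_ to _∈ₛ_)
open import Data.Fin.Subset.Properties using (p⊆q⇒∣p∣≤∣q∣; p⊂q⇒∣p∣<∣q∣; ∣p∣≤n)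
open import Data.List using (List; []; _∷_; _∷ʳ_; allFin; map; length; lookup; head; cartesianProduct; cartesianProductWith)
open import Data.List.Extrema.Nat using (xs≤max; max≤v⁺)
import Data.List.Membership.DecPropositional as DecMembership
open import Data.List.Membership.Propositional using (_∈_)
open import Data.List.Membership.Propositional.Properties
  using ( ∈-allFin; ∈-map⁺; ∈-lookup; ∈-cartesianProduct⁺; ∈-cartesianProduct⁻
        ; ∈-cartesianProductWith⁺; ∈-cartesianProductWith⁻ )
open import Data.List.Properties using (∷-injective; ∷-injectiveˡ)
import Data.List.Properties as List
open import Data.List.Relation.Unary.All as All using (All; []; _∷_)
import Data.List.Relation.Unary.All.Properties as All
open import Data.List.Relation.Unary.AllPairs using ([]; _∷_)
open import Data.List.Relation.Unary.Any using (here; there; index)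
open import Data.List.Relation.Unary.Any.Properties using (lookup-index)
open import Data.List.Relation.Unary.Linked using (Linked; [-]; _∷_)
open import Data.List.Relation.Unary.Unique.Propositional using (Unique)
import Data.List.Relation.Unary.Unique.Propositional.Properties as Unique
open import Data.Maybe as Maybe using (Maybe; just; nothing)
open import Data.Maybe.Properties as Maybe using (just-injective)
open import Data.Nat hiding (_≟_)
open import Data.Nat.Properties hiding (_≟_)
open import Data.Product as Product using (Σ-syntax; ∃; ∃₂; _×_; _,_; proj₁; proj₂)
open import Data.Sum as Sum using (_⊎_; inj₁; inj₂)
open import Data.Unit using (⊤; tt)
open import Data.Vec using (tabulate)
open import Data.Vec.Functional using (updateAt)
open import Data.Vec.Functional.Properties using (updateAt-updates; updateAt-minimal)
open import Data.Vec.Properties using (lookup∘tabulate; []=⇒lookup; lookup⇒[]=)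
open import Effect.Monad using (RawMonad)
open import Function using (_∘_; const; id)
open import Function.Bundles using (Equivalence; mk⇔)
open import Level using (0ℓ)
open import Relation.Binary using (REL)
import Relation.Binary as Binary
open import Relation.Binary.Construct.Closure.ReflexiveTransitive as Star using (Star; ε; _◅_; _◅◅_)
open import Relation.Binary.PropositionalEquality
open import Relation.Nullary using (¬_; Dec; does; yes; no; contradiction)
open import Relation.Nullary.Decidable using (dec-true; _×-dec_; _⊎-dec_; ¬?; ¬¬-excluded-middle)
open import Relation.Nullary.Negation using (¬¬-Monad)
open import Relation.Unary using (Pred; Decidable)
open import Algebra.Properties.Semiring.Sum +-*-semiring
  using (sum; sum-syntax; sum-cong-≗; ∑-distrib-+; ∑-comm; *-distribˡ-sum; *-distribʳ-sum)
open import Defs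

-- Counting and pigeonholes

private
  variable
    a b n : ℕ

-- Written so that degree G v is # (Graph._~?_ G v) by definition.
# : {P : Pred (Fin n) 0ℓ} → Decidable P → ℕ
# P? = ∣ tabulate (does ∘ P?) ∣

everything : (n : ℕ) → Decidable {A = Fin n} (λ _ → ⊤)
everything n _ = yes tt

module _ {P : Pred (Fin n) 0ℓ} (P? : Decidable P) where

  ∈-tabulate⁺ : ∀ {x} → P x → x ∈ₛ tabulate (does ∘ P?)
  ∈-tabulate⁺ {x} p =
    lookup⇒[]= x _ (trans (lookup∘tabulate (does ∘ P?) x) (dec-true (P? x) p))

  ∈-tabulate⁻ : ∀ {x} → x ∈ₛ tabulate (does ∘ P?) → P x
  ∈-tabulate⁻ {x} x∈
    with P? x | trans (sym (lookup∘tabulate (does ∘ P?) x)) ([]=⇒lookup x∈)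
  ... | yes p | _ = p

  #≤n : # P? ≤ n
  #≤n = ∣p∣≤n (tabulate (does ∘ P?))

module _ {P Q : Pred (Fin n) 0ℓ} (P? : Decidable P) (Q? : Decidable Q) where

  #-mono : (∀ {x} → P x → Q x) → # P? ≤ # Q?
  #-mono P⇒Q = p⊆q⇒∣p∣≤∣q∣ (∈-tabulate⁺ Q? ∘ P⇒Q ∘ ∈-tabulate⁻ P?)

  #-mono-< : (∀ {x} → P x → Q x) → ∀ {y} → Q y → ¬ P y → # P? < # Q?
  #-mono-< P⇒Q {y} q ¬p = p⊂q⇒∣p∣<∣q∣
    ( ∈-tabulate⁺ Q? ∘ P⇒Q ∘ ∈-tabulate⁻ P?
    , y , ∈-tabulate⁺ Q? q , ¬p ∘ ∈-tabulate⁻ P? )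

#-everything : ∀ n → # (everything n) ≡ n
#-everything zero    = refl
#-everything (suc n) = cong suc (#-everything n)

#-nonempty : {P : Pred (Fin n) 0ℓ} (P? : Decidable P) → 0 < # P? → ∃ P
#-nonempty {zero}  P? ()
#-nonempty {suc n} P? 0<# with P? zero
... | yes p = zero , p
... | no  _ = let x , p = #-nonempty (P? ∘ suc) 0<# in suc x , p

infixl 6 _∖_

_∖_ : {P : Pred (Fin n) 0ℓ} → Decidable P → (y : Fin n) →
      Decidable (λ x → P x × x ≢ y)
(P? ∖ y) x = P? x ×-dec ¬? (x Fin.≟ y)

#-∖ : {P : Pred (Fin n) 0ℓ} (P? : Decidable P) → ∀ y → # P? ≤ suc (# (P? ∖ y))
#-∖ {suc n} P? zero with P? zero
... | yes _ = s≤s (#-mono (P? ∘ suc) ((P? ∖ zero) ∘ suc) (λ p → p , λ ()))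
... | no  _ = m≤n⇒m≤1+n (#-mono (P? ∘ suc) ((P? ∖ zero) ∘ suc) (λ p → p , λ ()))
#-∖ {suc n} P? (suc y) with P? zero
... | yes _ = s≤s (≤-trans (#-∖ (P? ∘ suc) y)
    (s≤s (#-mono ((P? ∘ suc) ∖ y) ((P? ∖ suc y) ∘ suc) λ (p , x≢y) → p , x≢y ∘ Fin.suc-injective)))
... | no  _ = ≤-trans (#-∖ (P? ∘ suc) y)
    (s≤s (#-mono ((P? ∘ suc) ∖ y) ((P? ∖ suc y) ∘ suc) λ (p , x≢y) → p , x≢y ∘ Fin.suc-injective))

-- A relation in place of a function lets partial maps, such as the one from neighbours to the
-- colours of their edges, be passed directly. By induction on `a`, each element of `P` strikes at
-- most one value off `Q`.
pigeonhole : {P : Pred (Fin a) 0ℓ} {Q : Pred (Fin b) 0ℓ} {R : REL (Fin a) (Fin b) 0ℓ} →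
  (P? : Decidable P) (Q? : Decidable Q) (R? : Binary.Decidable R) →
  (∀ {x i j} → R x i → R x j → i ≡ j) → (∀ {x i} → R x i → P x) →
  # P? < # Q? → ∃ λ i → Q i × ∀ x → ¬ R x i
pigeonhole {zero} P? Q? R? func dom lt with i , q ← #-nonempty Q? lt = i , q , λ ()
pigeonhole {suc a} {P = P} {Q} {R} P? Q? R? func dom lt with Fin.any? (R? zero)
... | no ∄i = extend (pigeonhole (P? ∘ suc) Q? (R? ∘ suc) func dom (≤-<-trans tail≤ lt))
  where
  tail≤ : # (P? ∘ suc) ≤ # P?
  tail≤ with P? zero
  ... | yes _ = n≤1+n _
  ... | no  _ = ≤-refl
  extend : (∃ λ i → Q i × ∀ x → ¬ R (suc x) i) → ∃ λ i → Q i × ∀ x → ¬ R x i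
  extend (i , q , ¬R) = i , q , λ { zero r → ∄i (i , r) ; (suc x) → ¬R x }
... | yes (j , r) = extend
    (pigeonhole (P? ∘ suc) (Q? ∖ j) (R? ∘ suc) func dom
      (s≤s⁻¹ (≤-<-trans tail< (<-≤-trans lt (#-∖ Q? j)))))
  where
  tail< : suc (# (P? ∘ suc)) ≤ # P?
  tail< with P? zero
  ... | yes _ = ≤-refl
  ... | no ¬p = contradiction (dom r) ¬p
  extend : (∃ λ i → (Q i × i ≢ j) × ∀ x → ¬ R (suc x) i) → ∃ λ i → Q i × ∀ x → ¬ R x i
  extend (i , (q , i≢j) , ¬R) = i , q , λ { zero r′ → i≢j (func r′ r) ; (suc x) → ¬R x }

-- König's edge colouring theorem

module _ {n : ℕ} (i j : Fin n) where

  transpose-injective : ∀ {k l} → transpose i j k ≡ transpose i j l → k ≡ l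
  transpose-injective {k} {l} eq = begin
    k                                   ≡⟨ transpose-inverse j i ⟨
    transpose j i (transpose i j k)     ≡⟨ cong (transpose j i) eq ⟩
    transpose j i (transpose i j l)     ≡⟨ transpose-inverse j i ⟩
    l                                   ∎
    where open ≡-Reasoning

  transpose-fixes : ∀ {k} → k ≢ i → k ≢ j → transpose i j k ≡ k
  transpose-fixes {k} k≢i k≢j with k Fin.≟ i
  ... | yes k≡i = contradiction k≡i k≢i
  ... | no  _ with k Fin.≟ j
  ...   | yes k≡j = contradiction k≡j k≢j
  ...   | no  _   = refl

  transpose-left : transpose i j i ≡ j
  transpose-left with i Fin.≟ i
  ... | yes _  = refl
  ... | no i≢i = contradiction refl i≢i

-- Double negation passes through a finite product, so a predicate on vertices may be taken as
-- decidable while a negation is being proved.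
sequence-¬¬ : ∀ {n} {P : Fin n → Set} → (∀ i → ¬ ¬ P i) → ¬ ¬ (∀ i → P i)
sequence-¬¬ = Fin.sequence (RawMonad.rawApplicative ¬¬-Monad)

nothing≢just : ∀ {A : Set} {a : A} → nothing ≢ just a
nothing≢just ()

map-just⁻ : ∀ {A B : Set} {f : A → B} (m : Maybe A) {b} → Maybe.map f m ≡ just b →
            ∃ λ a → m ≡ just a × f a ≡ b
map-just⁻ (just a) eq = a , refl , just-injective eq

module ProperColourings (H : Graph) (bipartite : Bipartite H) (D : ℕ) where
  open Graph H using (_~_; _~?_; ~-sym)

  side : Vertex H → Bool
  side = proj₁ bipartite

  -- Colours sit on pairs of vertices, with `nothing` for a non-edge or an edge not yet coloured, so
  -- recolouring never has to carry adjacency proofs.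
  record PartialColouring : Set where
    field
      colour     : Vertex H → Vertex H → Maybe (Fin D)
      colour-sym : ∀ u v → colour u v ≡ colour v u
      proper     : ∀ {u v w i} → colour u v ≡ just i → colour u w ≡ just i → v ≡ w
      colour⇒~   : ∀ {u v i} → colour u v ≡ just i → u ~ v

    Coloured : Vertex H → Vertex H → Set
    Coloured u v = ∃ λ i → colour u v ≡ just i

    Missing : Vertex H → Fin D → Set
    Missing u i = ∀ w → colour u w ≢ just i

  open PartialColouring

  uncoloured : PartialColouring
  uncoloured = record
    { colour = λ _ _ → nothing ; colour-sym = λ _ _ → refl
    ; proper = λ () ; colour⇒~ = λ () }

  -- The edge from `u` to `v` is uncoloured, so at most `D - 1` colours occur at `u`.
  missing-colour : (c : PartialColouring) → ∀ {u v} → degree H u ≤ D → u ~ v →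
                   colour c u v ≡ nothing → ∃ (Missing c u)
  missing-colour c {u} {v} deg≤D u~v uv-free
    with pigeonhole ((u ~?_) ∖ v) (everything D)
           (λ w i → Maybe.≡-dec Fin._≟_ (colour c u w) (just i))
           (λ eq eq′ → just-injective (trans (sym eq) eq′))
           (λ {w} eq → colour⇒~ c eq ,
              λ { refl → nothing≢just (trans (sym uv-free) eq) })
           (<-≤-trans (#-mono-< ((u ~?_) ∖ v) (u ~?_) proj₁ u~v (λ (_ , v≢v) → v≢v refl))
             (≤-trans deg≤D (≤-reflexive (sym (#-everything D)))))
  ... | i , _ , missing = i , missing

  module Kempe (c : PartialColouring) (u : Vertex H) (α β : Fin D)
               (α-missing : Missing c u α) where

    -- The path of colours α and β that starts at u: it leaves the side of u
    -- through edges of colour β and comes back through edges of colour α.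
    data Chain : Vertex H → Set where
      start : Chain u
      go    : ∀ {x y} → side x ≡ side u → Chain x → colour c x y ≡ just β → Chain y
      back  : ∀ {x y} → side y ≢ side u → Chain y → colour c y x ≡ just α → Chain x

    opposite-side : ∀ {x y i} → colour c x y ≡ just i → side x ≢ side u → side y ≡ side u
    opposite-side eq x≢ =
      trans (Bool.¬-not (proj₂ bipartite (colour⇒~ c eq) ∘ sym)) (sym (Bool.¬-not (x≢ ∘ sym)))

    -- By bipartiteness `start` and `back` end on the side of `u`, so only a `β`-edge can have led
    -- to the other side.
    go-arrival : ∀ {x} → Chain x → side x ≢ side u →
                 ∃ λ w → Chain w × colour c x w ≡ just β
    go-arrival start           x≢ = contradiction refl x≢
    go-arrival (go {w} _ k eq) x≢ = w , k , trans (colour-sym c _ w) eq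
    go-arrival (back y≢ _ eq)  x≢ = contradiction (opposite-side eq y≢) x≢

    -- From the side of `u` the `β`-edge is the next step of the path. From the other side
    -- properness makes it the edge by which the path arrived, so it leads back into the chain.
    -- `back-closed` is the same with the roles of the sides exchanged.
    go-closed : ∀ {x y} → Chain x → colour c x y ≡ just β → Chain y
    go-closed {x} {y} k eq with side x Bool.≟ side u
    ... | yes x≡ = go x≡ k eq
    ... | no  x≢ with w , k′ , eq′ ← go-arrival k x≢ = subst Chain (proper c eq′ eq) k′

    back-closed : ∀ {x y} → Chain x → colour c x y ≡ just α → Chain y
    back-closed {x} {y} k eq with side x Bool.≟ side u
    ... | no  x≢ = back x≢ k eq
    ... | yes x≡ with k
    -- The path cannot continue beyond `u` in the other direction, since `α` is missing there.
    ...   | start            = contradiction eq (α-missing y)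
    ...   | go w≡ _ eq′      = contradiction (trans w≡ (sym x≡)) (proj₂ bipartite (colour⇒~ c eq′))
    ...   | back {y = w} _ k′ eq′ =
      subst Chain (proper c (trans (colour-sym c x w) eq′) eq) k′

    -- The parity argument behind König's theorem: the chain could reach the side opposite to `u`
    -- only through an edge of colour `β`.
    end∉ : ∀ {v} → side v ≢ side u → Missing c v β → ¬ Chain v
    end∉ v≢ β-missing k with w , _ , eq ← go-arrival k v≢ = β-missing w eq

    module _ (chain? : ∀ x → Dec (Chain x)) where

      switch : Vertex H → Fin D → Fin D
      switch x with chain? x
      ... | yes _ = transpose α β
      ... | no  _ = id

      switch-injective : ∀ x {i j} → switch x i ≡ switch x j → i ≡ j
      switch-injective x eq with chain? x
      ... | yes _ = transpose-injective α β eq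
      ... | no  _ = eq

      -- The chain is closed under edges of both colours, so an edge that leaves it has neither
      -- colour and the swap does not affect it.
      leaves : ∀ {x y i} → Chain x → ¬ Chain y → colour c x y ≡ just i →
               transpose α β i ≡ i
      leaves k ¬k eq = transpose-fixes α β
        (λ { refl → ¬k (back-closed k eq) }) (λ { refl → ¬k (go-closed k eq) })

      switch-sym : ∀ {x y i} → colour c x y ≡ just i → switch x i ≡ switch y i
      switch-sym {x} {y} eq with chain? x | chain? y
      ... | yes _ | yes _ = refl
      ... | yes k | no ¬k = leaves k ¬k eq
      ... | no ¬k | yes k = sym (leaves k ¬k (trans (colour-sym c y x) eq))
      ... | no  _ | no  _ = refl

      switched : PartialColouring
      switched .colour x y = Maybe.map (switch x) (colour c x y)
      switched .colour-sym x y with colour c x y in eq | colour c y x | colour-sym c x y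
      ... | nothing | _ | refl = refl
      ... | just i  | _ | refl = cong just (switch-sym eq)
      switched .proper {x} {y} {z} eq eq′
        with i , p , si ← map-just⁻ (colour c x y) eq
           | j , q , sj ← map-just⁻ (colour c x z) eq′ =
        proper c p (trans q (cong just (switch-injective x (trans sj (sym si)))))
      switched .colour⇒~ {x} {y} eq with i , p , _ ← map-just⁻ (colour c x y) eq = colour⇒~ c p

      switched-coloured : ∀ {x y} → Coloured c x y → Coloured switched x y
      switched-coloured {x} (i , eq) = switch x i , cong (Maybe.map (switch x)) eq

      switched-missing-start : Missing switched u β
      switched-missing-start w eq with i , p , si ← map-just⁻ (colour c u w) eq | chain? u
      ... | no ¬k = ¬k start
      -- An edge at `u` coloured `β` after the swap had colour `α` before it.
      ... | yes _ = α-missing w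
        (trans p (cong just (transpose-injective α β (trans si (sym (transpose-left α β))))))

      switched-missing-end : ∀ {v} → side v ≢ side u → Missing c v β → Missing switched v β
      switched-missing-end {v} v≢ β-missing w eq
        with i , p , si ← map-just⁻ (colour c v w) eq | chain? v
      ... | yes k = end∉ v≢ β-missing k
      ... | no  _ = β-missing w (trans p (cong just si))

  module _ (c : PartialColouring) {u v : Vertex H} {β : Fin D} (u~v : u ~ v)
           (u-missing : Missing c u β) (v-missing : Missing c v β) where

    new? : ∀ x y → Dec ((x ≡ u × y ≡ v) ⊎ (x ≡ v × y ≡ u))
    new? x y = (x Fin.≟ u ×-dec y Fin.≟ v) ⊎-dec (x Fin.≟ v ×-dec y Fin.≟ u)

    private
      u≢v : u ≢ v
      u≢v refl = proj₂ bipartite u~v refl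

    add : PartialColouring
    add .colour x y with new? x y
    ... | yes _ = just β
    ... | no  _ = colour c x y
    add .colour-sym x y with new? x y | new? y x
    ... | yes _ | yes _ = refl
    ... | yes p | no ¬p = contradiction (Sum.swap (Sum.map Product.swap Product.swap p)) ¬p
    ... | no ¬p | yes p = contradiction (Sum.swap (Sum.map Product.swap Product.swap p)) ¬p
    ... | no  _ | no  _ = colour-sym c x y
    add .proper {x} {y} {z} eq eq′ with new? x y | new? x z
    ... | yes (inj₁ (_ , refl)) | yes (inj₁ (_ , refl)) = refl
    ... | yes (inj₂ (_ , refl)) | yes (inj₂ (_ , refl)) = refl
    ... | yes (inj₁ (refl , _)) | yes (inj₂ (u≡v , _)) = contradiction u≡v u≢v
    ... | yes (inj₂ (refl , _)) | yes (inj₁ (v≡u , _)) = contradiction (sym v≡u) u≢v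
    ... | yes (inj₁ (refl , _)) | no _ = contradiction (trans eq′ (sym eq)) (u-missing z)
    ... | yes (inj₂ (refl , _)) | no _ = contradiction (trans eq′ (sym eq)) (v-missing z)
    ... | no _ | yes (inj₁ (refl , _)) = contradiction (trans eq (sym eq′)) (u-missing y)
    ... | no _ | yes (inj₂ (refl , _)) = contradiction (trans eq (sym eq′)) (v-missing y)
    ... | no _ | no _ = proper c eq eq′
    add .colour⇒~ {x} {y} eq with new? x y
    ... | yes (inj₁ (refl , refl)) = u~v
    ... | yes (inj₂ (refl , refl)) = ~-sym u~v
    ... | no _ = colour⇒~ c eq

    add-coloured : ∀ {x y} → Coloured c x y → Coloured add x y
    add-coloured {x} {y} (i , eq) with new? x y
    ... | yes _ = β , refl
    ... | no  _ = i , eq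

    add-new : Coloured add u v
    add-new with new? u v
    ... | yes _ = β , refl
    ... | no ¬p = contradiction (inj₁ (refl , refl)) ¬p

  infix 4 _⊑_

  _⊑_ : PartialColouring → PartialColouring → Set
  c ⊑ c′ = ∀ {x y} → Coloured c x y → Coloured c′ x y

  module _ (deg≤D : ∀ v → degree H v ≤ D) where

    -- Membership in a Kempe chain is decided only up to double negation,
    -- which is enough to refute arrowing.
    colour-edge : (c : PartialColouring) → ∀ {u v} → u ~ v →
                  ¬ ¬ (∃ λ c′ → c ⊑ c′ × Coloured c′ u v)
    colour-edge c {u} {v} u~v ¬∃ with colour c u v in eq
    ... | just i  = ¬∃ (c , id , i , eq)
    ... | nothing
      -- With `α` free at `u` and `β` free at `v`, swapping the two colours along the path from `u`
      -- frees `β` at `u`. The path avoids `v`, so `β` stays free there and can colour the new edge.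
      with α , α-missing ← missing-colour c (deg≤D u) u~v eq
         | β , β-missing ← missing-colour c (deg≤D v) (~-sym u~v) (trans (colour-sym c v u) eq) =
      sequence-¬¬ (λ _ → ¬¬-excluded-middle) λ chain? →
        let c₁ = switched chain?
            u-missing = switched-missing-start chain?
            v-missing = switched-missing-end chain? (proj₂ bipartite (~-sym u~v)) β-missing
        in ¬∃ ( add c₁ u~v u-missing v-missing
              , add-coloured c₁ u~v u-missing v-missing ∘ switched-coloured chain?
              , add-new c₁ u~v u-missing v-missing )
      where open Kempe c u α β α-missing

    colour-edges : (es : List (Vertex H × Vertex H)) →
      ¬ ¬ (∃ λ c → ∀ {u v} → (u , v) ∈ es → u ~ v → Coloured c u v)
    colour-edges []             ¬∃ = ¬∃ (uncoloured , λ ())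
    colour-edges ((u , v) ∷ es) ¬∃ = colour-edges es λ (c , done) → step c done (u ~? v)
      where
      step : ∀ c → (∀ {x y} → (x , y) ∈ es → x ~ y → Coloured c x y) → Dec (u ~ v) → ⊥
      step c done (no u≁v)  =
        ¬∃ (c , λ { (here refl) u~v → contradiction u~v u≁v ; (there e∈) → done e∈ })
      step c done (yes u~v) = colour-edge c u~v λ (c′ , c⊑c′ , uv) →
        ¬∃ (c′ , λ { (here refl) _ → uv ; (there e∈) x~y → c⊑c′ (done e∈ x~y) })

    proper-colouring : ¬ ¬ (∃ λ c → ∀ {u v} → u ~ v → Coloured c u v)
    proper-colouring ¬∃ = colour-edges (cartesianProduct (allFin _) (allFin _)) λ (c , done) →
      ¬∃ (c , done (∈-cartesianProduct⁺ (∈-allFin _) (∈-allFin _)))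

-- Lower bound: grouping the colours of a proper colouring

degree≤Δ : ∀ H v → degree H v ≤ Δ H
degree≤Δ H v = All.lookup (xs≤max 0 (map (degree H) (allFin _))) (∈-map⁺ (degree H) (∈-allFin v))

Δ≤ : ∀ H {d} → (∀ v → degree H v ≤ d) → Δ H ≤ d
Δ≤ H deg≤d = max≤v⁺ z≤n (All.map⁺ (All.universal deg≤d (allFin _)))

-- The `s * k` proper colours form `s` groups of `k`, and a vertex meets at most `k` edges of each
-- group. The goal is a negation once `≰⇒>` is applied, so a proper colouring up to double negation
-- suffices.
arrowing⇒large-Δ : ∀ {H T s k} → Bipartite H → H ⟶[ s ] T → ∀ r → k < degree T r → s * k < Δ H
arrowing⇒large-Δ {H} {T} {s} {k} bipartite H⟶T r k<deg = ≰⇒> λ Δ≤sk →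
  proper-colouring (λ v → ≤-trans (degree≤Δ H v) Δ≤sk) refute
  where
  open ProperColourings H bipartite (s * k)
  open PartialColouring
  open Graph H using (_~_)
  open Graph T using () renaming (_~_ to _~ᵀ_; _~?_ to _~ᵀ?_)

  refute : ¬ (∃ λ c → ∀ {u v} → u ~ v → Coloured c u v)
  refute (c , coloured)
    with S , (i , mono) , T≅S ← H⟶T record
           { colour = quotient k ∘ proj₁ ∘ coloured
           ; colour-unordered = λ {u} {v} e e′ → cong (quotient k) (just-injective
               (trans (sym (proj₂ (coloured e)))
                      (trans (colour-sym c u v) (proj₂ (coloured e′))))) }
    with _≅_.to T≅S | _≅_.injective T≅S | (λ x → Equivalence.to (_≅_.adjacency T≅S r x))
  ... | φ | φ-injective | φ-edge
    -- The `k` positions within group `i` are matched with the more than `k` neighbours of `r`. Some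
    -- neighbour is left without a position, although the edge to its image lies in group `i`.
    with x , r~x , unused ← pigeonhole (everything k) (r ~ᵀ?_)
           (λ q x → r ~ᵀ? x ×-dec Maybe.≡-dec Fin._≟_ (colour c (φ r) (φ x)) (just (combine i q)))
           (λ (_ , p) (_ , p′) → φ-injective (proper c p p′)) _
           (≤-<-trans (≤-reflexive (#-everything k)) k<deg)
    =
    let e = φ-edge x r~x
        j , eq = coloured (Subgraph.E⇒~ S e)
        open ≡-Reasoning
    in unused (remainder {s} k j) (r~x , trans eq (cong just (begin
      j                                            ≡⟨ Fin.combine-remQuot {s} k j ⟨
      combine (quotient {s} k j) (remainder {s} k j)   ≡⟨ cong (λ a → combine a (remainder {s} k j)) (mono e) ⟩
      combine i (remainder {s} k j)                ∎)))

-- Regular bipartite graphs without short cycles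

Word : ℕ → Set
Word d = List (Fin d)

-- The edge of letter `i` at `v` leads to `σ i v`. Away from the good vertices several letters may
-- lead to the same neighbour, so regularity and the tree-like structure are only claimed at good
-- ones.
record RegularGraph (d R : ℕ) : Set₁ where
  field
    order        : ℕ
    σ            : Fin d → Fin order → Fin order
    σ-involutive : ∀ i v → σ i (σ i v) ≡ v
    side         : Fin order → Bool
    side-σ       : ∀ i v → side (σ i v) ≡ not (side v)
    Good         : Fin order → Set
    good?        : ∀ v → Dec (Good v)
    good-σ       : ∀ i {v} → Good v → Good (σ i v)
    origin       : ∃ Good
    -- Around a good vertex the graph looks like a tree up to distance R.
    unfold       : ∀ {v} → Good v → ∃ λ (label : Fin order → Word d) →
                   label v ≡ [] ×
                   (∀ i u → length (label u) < R → head (label u) ≢ just i →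
                            label (σ i u) ≡ i ∷ label u)

lookup-injective : ∀ {A : Set} {xs : List A} → Unique xs → ∀ {i j} →
                   lookup xs i ≡ lookup xs j → i ≡ j
lookup-injective (_    ∷ _)  {zero}  {zero}  _  = refl
lookup-injective (x∉xs ∷ _)  {zero}  {suc j} eq = contradiction eq (All.lookup x∉xs (∈-lookup j))
lookup-injective (x∉xs ∷ _)  {suc i} {zero}  eq = contradiction (sym eq) (All.lookup x∉xs (∈-lookup i))
lookup-injective (_    ∷ !xs) {suc i} {suc j} eq = cong suc (lookup-injective !xs eq)

module _ {d : ℕ} where

  starts? : ∀ (w : Word d) i → Dec (head w ≡ just i)
  starts? w i = Maybe.≡-dec Fin._≟_ (head w) (just i)

  -- Fixing the words that start with i twice makes this an involution on
  -- all words, reduced or not.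
  toggle : Fin d → Word d → Word d
  toggle i []      = i ∷ []
  toggle i (j ∷ w) with i Fin.≟ j | starts? w i
  ... | no  _ | _     = i ∷ j ∷ w
  ... | yes _ | yes _ = j ∷ w
  ... | yes _ | no  _ = w

  toggle-unstarted : ∀ {i} w → head w ≢ just i → toggle i w ≡ i ∷ w
  toggle-unstarted []      _ = refl
  toggle-unstarted {i} (j ∷ w) ≢i with i Fin.≟ j
  ... | yes refl = contradiction refl ≢i
  ... | no  _    = refl

  toggle-started : ∀ {i} w → head w ≢ just i → toggle i (i ∷ w) ≡ w
  toggle-started {i} w ≢i with i Fin.≟ i | starts? w i
  ... | no i≢i | _      = contradiction refl i≢i
  ... | yes _  | yes ≡i = contradiction ≡i ≢i
  ... | yes _  | no  _  = refl

  toggle-involutive : ∀ i w → toggle i (toggle i w) ≡ w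
  toggle-involutive i []      = toggle-started [] (λ ())
  toggle-involutive i (j ∷ w) with i Fin.≟ j | starts? w i in eq
  ... | no i≢j   | _      = toggle-started (j ∷ w) (i≢j ∘ sym ∘ just-injective)
  ... | yes refl | no ≢i  = toggle-unstarted w ≢i
  ... | yes refl | yes ≡i with i Fin.≟ i
  ...   | no i≢i = contradiction refl i≢i
  ...   | yes _ rewrite eq = refl

  words : ℕ → List (Word d)
  words zero    = [] ∷ []
  words (suc R) = [] ∷ cartesianProductWith _∷_ (allFin d) (words R)

  words-unique : ∀ R → Unique (words R)
  words-unique zero    = [] ∷ []
  words-unique (suc R) =
    All.tabulate (λ w∈ → nonempty (∈-cartesianProductWith⁻ _∷_ (allFin d) (words R) w∈)) ∷
    Unique.cartesianProductWith⁺ _∷_ ∷-injective (Unique.allFin⁺ d) (words-unique R)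
    where
    nonempty : ∀ {w} → (∃₂ λ i u → i ∈ allFin d × u ∈ words R × w ≡ i ∷ u) → [] ≢ w
    nonempty (_ , _ , _ , _ , refl) ()

  ∈-words⁺ : ∀ {R} w → length w ≤ R → w ∈ words R
  ∈-words⁺ {zero}  []      _       = here refl
  ∈-words⁺ {suc R} []      _       = here refl
  ∈-words⁺ {suc R} (i ∷ w) (s≤s ≤R) =
    there (∈-cartesianProductWith⁺ _∷_ (∈-allFin i) (∈-words⁺ w ≤R))

  ∈-words⁻ : ∀ R {w} → w ∈ words R → length w ≤ R
  ∈-words⁻ zero    (here refl) = z≤n
  ∈-words⁻ (suc R) (here refl) = z≤n
  ∈-words⁻ (suc R) (there w∈)
    with _ , _ , _ , u∈ , refl ← ∈-cartesianProductWith⁻ _∷_ (allFin d) (words R) w∈ = s≤s (∈-words⁻ R u∈)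

module _ (d R : ℕ) where

  -- Every move flips the Boolean. This keeps the graph bipartite and free of loops even where
  -- `bounded` fixes the word.
  Point : Set
  Point = Bool × Word d

  -- Truncation to a finite set of words: a letter that would make the word too long fixes it
  -- instead. A fixed word is fixed again at the second application, so the result is still an
  -- involution.
  bounded : Fin d → Word d → Word d
  bounded i w with length (toggle i w) ≤? R
  ... | yes _ = toggle i w
  ... | no  _ = w

  bounded-≤ : ∀ i w → length w ≤ R → length (bounded i w) ≤ R
  bounded-≤ i w ≤R with length (toggle i w) ≤? R
  ... | yes p = p
  ... | no  _ = ≤R

  bounded-extends : ∀ i w → length w < R → head w ≢ just i → bounded i w ≡ i ∷ w
  bounded-extends i w <R ≢i with length (toggle i w) ≤? R
  ... | yes _ = toggle-unstarted w ≢i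
  ... | no ≰R = contradiction (subst (λ u → length u ≤ R) (sym (toggle-unstarted w ≢i)) <R) ≰R

  bounded-involutive : ∀ i w → length w ≤ R → bounded i (bounded i w) ≡ w
  bounded-involutive i w ≤R with length (toggle i w) ≤? R in eq
  ... | yes _ with length (toggle i (toggle i w)) ≤? R
  ...   | yes _ = toggle-involutive i w
  ...   | no ≰R = contradiction (subst (λ u → length u ≤ R) (sym (toggle-involutive i w)) ≤R) ≰R
  bounded-involutive i w ≤R | no _ rewrite eq = refl

  points : List Point
  points = cartesianProduct (true ∷ false ∷ []) (words R)

  points-unique : Unique points
  points-unique = Unique.cartesianProduct⁺ (((λ ()) ∷ []) ∷ [] ∷ []) (words-unique R)

  ∈-points : ∀ b w → length w ≤ R → (b , w) ∈ points
  ∈-points b w ≤R = ∈-cartesianProduct⁺ (∈-bools b) (∈-words⁺ w ≤R)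
    where
    ∈-bools : ∀ b → b ∈ true ∷ false ∷ []
    ∈-bools true  = here refl
    ∈-bools false = there (here refl)

  m : ℕ
  m = length points

  point : Fin m → Point
  point = lookup points

  word-≤ : ∀ x → length (proj₂ (point x)) ≤ R
  word-≤ x = ∈-words⁻ R (proj₂ (∈-cartesianProduct⁻ (true ∷ false ∷ []) (words R) (∈-lookup x)))

  move-∈ : ∀ i x → (not (proj₁ (point x)) , bounded i (proj₂ (point x))) ∈ points
  move-∈ i x = ∈-points _ _ (bounded-≤ i (proj₂ (point x)) (word-≤ x))

  move : Fin d → Fin m → Fin m
  move i x = index (move-∈ i x)

  point-move : ∀ i x → point (move i x) ≡ (not (proj₁ (point x)) , bounded i (proj₂ (point x)))
  point-move i x = sym (lookup-index (move-∈ i x))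

  move-involutive : ∀ i x → move i (move i x) ≡ x
  move-involutive i x = lookup-injective points-unique (begin
    point (move i (move i x))  ≡⟨ point-move i (move i x) ⟩
    (not (proj₁ (point (move i x))) , bounded i (proj₂ (point (move i x))))
      ≡⟨ cong (λ p → not (proj₁ p) , bounded i (proj₂ p)) (point-move i x) ⟩
    (not (not (proj₁ (point x))) , bounded i (bounded i (proj₂ (point x))))
      ≡⟨ cong₂ _,_ (Bool.not-involutive _) (bounded-involutive i _ (word-≤ x)) ⟩
    point x                    ∎)
    where open ≡-Reasoning

  x₀ : Fin m
  x₀ = index (∈-points true [] z≤n)

  point-x₀ : point x₀ ≡ (true , [])
  point-x₀ = sym (lookup-index (∈-points true [] z≤n))

funToFin-cong : ∀ {m n} {f g : Fin m → Fin n} → f ≗ g → funToFin f ≡ funToFin g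
funToFin-cong {zero}  f≗g = refl
funToFin-cong {suc m} f≗g = cong₂ combine (f≗g zero) (funToFin-cong (f≗g ∘ suc))

-- The vertices are the self-maps of the set of points, on which the
-- involutions act by composition.  Near a surjective map u₀, a vertex u is
-- labelled by the word of its value at a fixed preimage of x₀ under u₀.
regularGraph : ∀ d R → RegularGraph d R
regularGraph d R = record
  { order        = M ^ M
  ; σ            = σ
  ; σ-involutive = λ i v → trans
      (funToFin-cong (λ x → trans (cong (move d R i) (at-σ i v x)) (move-involutive d R i (at v x))))
      (Fin.funToFin-finToFin {M} {M} v)
  ; side         = λ v → proj₁ (point d R (at v (x₀ d R)))
  ; side-σ       = λ i v → cong proj₁ (point-at-σ i v (x₀ d R))
  ; Good         = λ v → ∀ y → ∃ λ x → at v x ≡ y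
  ; good?        = λ v → Fin.all? λ y → Fin.any? λ x → at v x Fin.≟ y
  -- A point that `v` sends to `move d R i y` is sent to `y` after one more move.
  ; good-σ       = λ i {v} surj y → let x , eq = surj (move d R i y) in
      x , trans (at-σ i v x) (trans (cong (move d R i) eq) (move-involutive d R i y))
  ; origin       = funToFin {M} {M} id , λ y → y , Fin.finToFun-funToFin {M} {M} id y
  ; unfold       = λ {v} surj → let x , eq = surj (x₀ d R) in
        (λ u → proj₂ (point d R (at u x)))
      , trans (cong (proj₂ ∘ point d R) eq) (cong proj₂ (point-x₀ d R))
      , λ i u <R ≢i → trans (cong proj₂ (point-at-σ i u x)) (bounded-extends d R i _ <R ≢i)
  }
  where
  M = m d R

  at : Fin (M ^ M) → Fin M → Fin M
  at = finToFun {M} {M}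

  σ : Fin d → Fin (M ^ M) → Fin (M ^ M)
  σ i v = funToFin (move d R i ∘ at v)

  at-σ : ∀ i v x → at (σ i v) x ≡ move d R i (at v x)
  at-σ i v = Fin.finToFun-funToFin (move d R i ∘ at v)

  point-at-σ : ∀ i v x → let b , w = point d R (at v x) in
               point d R (at (σ i v) x) ≡ (not b , bounded d R i w)
  point-at-σ i v x = trans (cong (point d R) (at-σ i v x)) (point-move d R i (at v x))

-- Greedy embedding of a tree into reduced words

module SimplePaths (G : Graph) (P : Pred (Vertex G) 0ℓ) where
  open Graph G using (_~_; ~-sym)
  open DecMembership (Fin._≟_ {Graph.order G}) using (_∈?_)

  -- Simple paths inside `P`, indexed by their vertex lists in the form that `Acyclic` speaks about.
  data Path : Vertex G → Vertex G → List (Vertex G) → Set where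
    stop : ∀ {x} → P x → Path x x (x ∷ [])
    step : ∀ {x y z vs} → P x → x ~ y → All (x ≢_) vs → Path y z vs → Path x z (x ∷ vs)

  path-from : ∀ {x y z vs} → x ∈ vs → Path y z vs → ∃ (Path x z)
  path-from (here refl) p@(stop _)       = _ , p
  path-from (here refl) p@(step _ _ _ _) = _ , p
  path-from (there x∈)  (step _ _ _ p)   = path-from x∈ p

  path-unique : ∀ {x z vs} → Path x z vs → Unique vs
  path-unique (stop _)        = [] ∷ []
  path-unique (step _ _ x∉ p) = x∉ ∷ path-unique p

  path-within : ∀ {x z vs} → Path x z vs → All P vs
  path-within (stop px)       = px ∷ []
  path-within (step px _ _ p) = px ∷ path-within p

  path-linked : ∀ {x y z vs} → Path x z vs → z ~ y → Linked _~_ (vs ∷ʳ y)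
  path-linked (stop _)                          z~y = z~y ∷ [-]
  path-linked (step _ x~ _ p@(stop _))       z~y = x~ ∷ path-linked p z~y
  path-linked (step _ x~ _ p@(step _ _ _ _)) z~y = x~ ∷ path-linked p z~y

  -- Loop erasure: when the walk returns to a vertex of the path, everything before that visit is
  -- dropped.
  walk⇒path : ∀ {x z} → P z → Star (λ a b → P a × a ~ b) x z → ∃ (Path x z)
  walk⇒path pz ε = _ , stop pz
  walk⇒path {x} pz ((px , x~y) ◅ walk) with vs , p ← walk⇒path pz walk with x ∈? vs
  ... | yes x∈ = path-from x∈ p
  ... | no  x∉ = _ , step px x~y (All.¬Any⇒All¬ vs x∉) p

  -- If `x` and `z` were distinct, a simple path between them inside `P` would close to a cycle
  -- through `y`, which lies outside `P`.
  unique-attachment : Graph.Acyclic G → ∀ {x y z} → ¬ P y → x ~ y → z ~ y → P z →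
                      Star (λ a b → P a × a ~ b) x z → x ≡ z
  unique-attachment acyclic {x} {y} {z} ¬py x~y z~y pz walk = close (proj₂ (walk⇒path pz walk))
    where
    y∉ : ∀ {a vs} → Path a z vs → All (y ≢_) vs
    y∉ p = All.map (λ { pv refl → ¬py pv }) (path-within p)

    close : ∀ {vs} → Path x z vs → x ≡ z
    close (stop _) = refl
    close p@(step _ _ _ (stop _))       =
      contradiction (y∉ p ∷ path-unique p , ~-sym x~y ∷ path-linked p z~y) (acyclic _ _ _ _)
    close p@(step _ _ _ (step _ _ _ _)) =
      contradiction (y∉ p ∷ path-unique p , ~-sym x~y ∷ path-linked p z~y) (acyclic _ _ _ _)

crossing : ∀ {A : Set} {R : A → A → Set} {P : Pred A 0ℓ} → Decidable P →
           ∀ {x z} → Star R x z → P x → ¬ P z → ∃₂ λ a b → R a b × P a × ¬ P b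
crossing P? ε                    px ¬pz = contradiction px ¬pz
crossing P? (_◅_ {j = y} r walk) px ¬pz with P? y
... | yes py = crossing P? walk py ¬pz
... | no ¬py = _ , _ , r , px , ¬py

just? : ∀ {A : Set} (m : Maybe A) → Dec (∃ λ a → m ≡ just a)
just? (just a) = yes (a , refl)
just? nothing  = no λ ()

updateAt-cases : ∀ {n} {A : Set} (f : Fin n → Maybe A) {y a z b} →
  updateAt f y (const (just a)) z ≡ just b → (z ≡ y × b ≡ a) ⊎ f z ≡ just b
updateAt-cases f {y} {z = z} eq with z Fin.≟ y
... | yes refl = inj₁ (refl , just-injective (trans (sym eq) (updateAt-updates y f)))
... | no  z≢y  = inj₂ (trans (sym (updateAt-minimal z y f z≢y)) eq)

head-just : ∀ {A : Set} {xs : List A} {x} → head xs ≡ just x → ∃ λ ys → xs ≡ x ∷ ys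
head-just {xs = x ∷ xs} refl = xs , refl

-- A word lists the steps taken from the root, last step first. `Q w i` permits the step `i` from
-- the position `w`; it will mean that this step follows an edge of the chosen colour and stays in
-- the core.
module WordEmbedding
  (T : Graph) (tree : IsTree T) (r : Vertex T) {d : ℕ}
  {Q : Word d → Pred (Fin d) 0ℓ} (Q? : ∀ w → Decidable (Q w)) where

  open Graph T using (_~_; _~?_; ~-sym; order)

  data Valid : Word d → Set where
    []  : Valid []
    _∷_ : ∀ {i w} → Q w i × head w ≢ just i → Valid w → Valid (i ∷ w)

  Child : Word d → Word d → Set
  Child w w′ = ∃ λ i → w′ ≡ i ∷ w

  word≢longer : ∀ {i j : Fin d} {w} → w ≢ i ∷ j ∷ w
  word≢longer eq = <⇒≢ (≤-trans (n<1+n _) (n≤1+n _)) (cong length eq)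

  record Embedding : Set where
    field
      ω           : Vertex T → Word d
      ω-injective : ∀ {x y} → ω x ≡ ω y → x ≡ y
      ω-valid     : ∀ x → Valid (ω x)
      ω-length    : ∀ x → length (ω x) ≤ order
      ω-edge      : ∀ {x y} → x ~ y → Child (ω x) (ω y) ⊎ Child (ω y) (ω x)

  -- The state after `t` extensions: `t` bounds the word lengths and, by `size`, the progress. By
  -- `ω-parent` the placed vertices contain the parents of their members, so they stay connected to
  -- the root.
  record PartialEmbedding (t : ℕ) : Set where
    field
      ω           : Vertex T → Maybe (Word d)
      ω-root      : ω r ≡ just []
      ω-injective : ∀ {x y w} → ω x ≡ just w → ω y ≡ just w → x ≡ y
      ω-parent    : ∀ {x i w} → ω x ≡ just (i ∷ w) → ∃ λ p → ω p ≡ just w × p ~ x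
      ω-edge      : ∀ {x y w w′} → x ~ y → ω x ≡ just w → ω y ≡ just w′ → Child w w′ ⊎ Child w′ w
      ω-valid     : ∀ {x w} → ω x ≡ just w → Valid w
      ω-length    : ∀ {x w} → ω x ≡ just w → length w ≤ t

    Placed : Vertex T → Set
    Placed x = ∃ λ w → ω x ≡ just w

    placed? : ∀ x → Dec (Placed x)
    placed? x = just? (ω x)

    field
      size : t < # placed?

    -- Each step records that both its ends are placed, which allows `walk` to reverse the second
    -- half.
    walk-to-root : ∀ {x} w → ω x ≡ just w → Star (λ a b → (Placed a × a ~ b) × Placed b) x r
    walk-to-root []      eq with refl ← ω-injective eq ω-root = ε
    walk-to-root (i ∷ w) eq with p , eqₚ , p~x ← ω-parent eq =
      (((_ , eq) , ~-sym p~x) , _ , eqₚ) ◅ walk-to-root w eqₚ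

    walk : ∀ {x z} → Placed x → Placed z → Star (λ a b → Placed a × a ~ b) x z
    walk (w , eq) (w′ , eq′) = Star.gmap id proj₁
      (walk-to-root w eq ◅◅ Star.reverse (λ ((pa , a~b) , pb) → (pb , ~-sym a~b) , pa) (walk-to-root w′ eq′))

  open PartialEmbedding

  root-only : PartialEmbedding 0
  root-only = record
    { ω           = ω₀
    ; ω-root      = root
    ; ω-injective = λ p q → trans (at-root p .proj₁) (sym (at-root q .proj₁))
    ; ω-parent    = λ p → contradiction (at-root p .proj₂) λ ()
    ; ω-edge      = λ x~y p q → contradiction x~y
        (Graph.~-irrefl T (trans (at-root p .proj₁) (sym (at-root q .proj₁))))
    ; ω-valid     = λ p → subst Valid (sym (at-root p .proj₂)) []
    ; ω-length    = λ p → ≤-reflexive (cong length (at-root p .proj₂))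
    ; size        = ≤-<-trans z≤n (#-mono-< (λ _ → no id) (just? ∘ ω₀) ⊥-elim ([] , root) id)
    }
    where
    ω₀ : Vertex T → Maybe (Word d)
    ω₀ = updateAt (const nothing) r (const (just []))
    root : ω₀ r ≡ just []
    root = updateAt-updates r _
    at-root : ∀ {x w} → ω₀ x ≡ just w → x ≡ r × w ≡ []
    at-root {x} eq with updateAt-cases (const nothing) {r} {z = x} eq
    ... | inj₁ x≡r,w≡[] = x≡r,w≡[]

  -- The large degree of `r` has to be matched at the empty word only, as `r` is placed nowhere
  -- else.
  module _ (degree≤ : ∀ x {w} → Valid w → (x ≡ r → w ≡ []) → degree T x ≤ # (Q? w)) where

    module Extension {t} (e : PartialEmbedding t) {x y w} (x~y : x ~ y)
                     (ωx : ω e x ≡ just w) (y-unplaced : ¬ Placed e y) where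

      -- The letter i leads from x to its child z or to its parent z.
      Taken : Vertex T → Fin d → Set
      Taken z i = ω e z ≡ just (i ∷ w) ⊎ Maybe.map (i ∷_) (ω e z) ≡ just w

      _≟ʷ_ : ∀ (u v : Maybe (Word d)) → Dec (u ≡ v)
      _≟ʷ_ = Maybe.≡-dec (List.≡-dec Fin._≟_)

      taken? : ∀ z i → Dec (Taken z i)
      taken? z i = (ω e z ≟ʷ just (i ∷ w)) ⊎-dec (Maybe.map (i ∷_) (ω e z) ≟ʷ just w)

      taken-functional : ∀ {z i j} → Taken z i → Taken z j → i ≡ j
      taken-functional (inj₁ p) (inj₁ q) =
        ∷-injectiveˡ (just-injective (trans (sym p) q))
      taken-functional {z} (inj₁ p) (inj₂ q) with _ , p′ , q′ ← map-just⁻ (ω e z) q =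
        contradiction (trans (sym q′) (cong (_ ∷_) (just-injective (trans (sym p′) p)))) word≢longer
      taken-functional {z} (inj₂ q) (inj₁ p) with _ , p′ , q′ ← map-just⁻ (ω e z) q =
        contradiction (trans (sym q′) (cong (_ ∷_) (just-injective (trans (sym p′) p)))) word≢longer
      taken-functional {z} (inj₂ p) (inj₂ q)
        with _ , _ , p′ ← map-just⁻ (ω e z) p | _ , _ , q′ ← map-just⁻ (ω e z) q =
        ∷-injectiveˡ (trans p′ (sym q′))

      placed≢y : ∀ {z} → Placed e z → z ≢ y
      placed≢y pz refl = y-unplaced pz

      taken⇒neighbour : ∀ {z i} → Taken z i → x ~ z × z ≢ y
      taken⇒neighbour (inj₁ p) with q , ωq , q~z ← ω-parent e p
        with refl ← ω-injective e ωx ωq = q~z , placed≢y (_ , p)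
      taken⇒neighbour {z} (inj₂ p) with _ , ωz , refl ← map-just⁻ (ω e z) p
        with q , ωq , q~x ← ω-parent e ωx
        with refl ← ω-injective e ωz ωq = ~-sym q~x , placed≢y (_ , ωz)

      root-word : x ≡ r → w ≡ []
      root-word refl = just-injective (trans (sym ωx) (ω-root e))

      -- The neighbours of `x` other than `y` number less than its degree, and each takes at most
      -- one letter. The letter back to the parent counts as taken, so the new word is reduced.
      free-letter : ∃ λ i → Q w i × ∀ z → ¬ Taken z i
      free-letter = pigeonhole ((x ~?_) ∖ y) (Q? w) taken? taken-functional taken⇒neighbour
        (<-≤-trans (#-mono-< ((x ~?_) ∖ y) (x ~?_) proj₁ x~y (λ (_ , y≢y) → y≢y refl))
                   (degree≤ x (ω-valid e ωx) root-word))

      i : Fin d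
      i = proj₁ free-letter

      untaken : ∀ z → ¬ Taken z i
      untaken = proj₂ (proj₂ free-letter)

      head≢ : head w ≢ just i
      head≢ eq with w′ , w≡ ← head-just eq
        with p , ωp , _ ← ω-parent e (trans ωx (cong just w≡)) =
        untaken p (inj₂ (trans (cong (Maybe.map (i ∷_)) ωp) (cong just (sym w≡))))

      ω′ : Vertex T → Maybe (Word d)
      ω′ = updateAt (ω e) y (const (just (i ∷ w)))

      ω′-new : ω′ y ≡ just (i ∷ w)
      ω′-new = updateAt-updates y (ω e)

      ω′-old : ∀ {z v} → ω e z ≡ just v → ω′ z ≡ just v
      ω′-old ωz = trans (updateAt-minimal _ y (ω e) (placed≢y (_ , ωz))) ωz

      ω′-cases : ∀ {z v} → ω′ z ≡ just v → (z ≡ y × v ≡ i ∷ w) ⊎ ω e z ≡ just v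
      ω′-cases = updateAt-cases (ω e)

      -- This is where acyclicity enters: `x` is the only placed neighbour of `y`, so placing `y`
      -- creates no other edge that would have to be respected.
      attached : ∀ {z v} → z ~ y → ω e z ≡ just v → v ≡ w
      attached z~y ωz
        with refl ← SimplePaths.unique-attachment T (Placed e) (proj₂ tree) y-unplaced x~y z~y
                      (_ , ωz) (walk e (_ , ωx) (_ , ωz)) =
        just-injective (trans (sym ωz) ωx)

      extended : PartialEmbedding (suc t)
      extended .ω = ω′
      extended .ω-root = ω′-old (ω-root e)
      extended .ω-injective p q with ω′-cases p | ω′-cases q
      ... | inj₁ (refl , refl) | inj₁ (refl , _)    = refl
      ... | inj₁ (refl , refl) | inj₂ ωz            = contradiction (inj₁ ωz) (untaken _)
      ... | inj₂ ωz            | inj₁ (refl , refl) = contradiction (inj₁ ωz) (untaken _)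
      ... | inj₂ ωz            | inj₂ ωz′           = ω-injective e ωz ωz′
      extended .ω-parent p with ω′-cases p
      ... | inj₁ (refl , refl) = x , ω′-old ωx , x~y
      ... | inj₂ ωz with q , ωq , q~z ← ω-parent e ωz = q , ω′-old ωq , q~z
      extended .ω-edge a~b p q with ω′-cases p | ω′-cases q
      ... | inj₁ (refl , refl) | inj₁ (refl , _)    = contradiction a~b (Graph.~-irrefl T refl)
      ... | inj₁ (refl , refl) | inj₂ ωb            = inj₂ (i , cong (i ∷_) (sym (attached (~-sym a~b) ωb)))
      ... | inj₂ ωa            | inj₁ (refl , refl) = inj₁ (i , cong (i ∷_) (sym (attached a~b ωa)))
      ... | inj₂ ωa            | inj₂ ωb            = ω-edge e a~b ωa ωb
      extended .ω-valid p with ω′-cases p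
      ... | inj₁ (_ , refl) = (proj₁ (proj₂ free-letter) , head≢) ∷ ω-valid e ωx
      ... | inj₂ ωz         = ω-valid e ωz
      extended .ω-length p with ω′-cases p
      ... | inj₁ (_ , refl) = s≤s (ω-length e ωx)
      ... | inj₂ ωz         = m≤n⇒m≤1+n (ω-length e ωz)
      extended .size = ≤-<-trans (size e) (#-mono-< (placed? e) (just? ∘ ω′)
        (λ (v , ωz) → v , ω′-old ωz) (i ∷ w , ω′-new) y-unplaced)

    total : ∀ {t} (e : PartialEmbedding t) → (∀ x → Placed e x) → Embedding
    total {t} e placed = record
      { ω = proj₁ ∘ placed
      ; ω-injective = λ {x} {y} eq →
          ω-injective e (proj₂ (placed x)) (trans (proj₂ (placed y)) (cong just (sym eq)))
      ; ω-valid = λ x → ω-valid e (proj₂ (placed x))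
      ; ω-length = λ x → ≤-trans (ω-length e (proj₂ (placed x)))
                           (<⇒≤ (<-≤-trans (size e) (#≤n (placed? e))))
      ; ω-edge = λ {x} {y} x~y → ω-edge e x~y (proj₂ (placed x)) (proj₂ (placed y))
      }

    complete : ∀ fuel {t} → fuel + t ≡ order → PartialEmbedding t → Embedding
    -- Here `t` equals `order`, and `size` would place more vertices than there are.
    complete zero refl e = contradiction (size e) (≤⇒≯ (#≤n (placed? e)))
    complete (suc fuel) {t} eq e with Fin.all? (placed? e)
    ... | yes placed = total e placed
    ... | no ¬placed
      with z , z-unplaced ← Fin.¬∀⟶∃¬ order (Placed e) (placed? e) ¬placed
      with x , y , x~y , (_ , ωx) , y-unplaced ←
             crossing (placed? e) (proj₂ (proj₁ tree) r z) (_ , ω-root e) z-unplaced =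
      complete fuel (trans (+-suc fuel t) eq) (Extension.extended e x~y ωx y-unplaced)

    embedding : Embedding
    embedding = complete order (+-identityʳ order) root-only

-- Dense colour classes and their cores

𝟙 : {P : Set} → Dec P → ℕ
𝟙 P? = if does P? then 1 else 0

𝟙≤ : {P : Set} (P? : Dec P) {m : ℕ} → (P → 1 ≤ m) → 𝟙 P? ≤ m
𝟙≤ (yes p) 1≤m = 1≤m p
𝟙≤ (no _)  _   = z≤n

≤𝟙 : {P : Set} (P? : Dec P) → P → 1 ≤ 𝟙 P?
≤𝟙 (yes _) _ = ≤-refl
≤𝟙 (no ¬p) p = contradiction p ¬p

#≡∑ : {P : Pred (Fin n) 0ℓ} (P? : Decidable P) → # P? ≡ ∑[ x < n ] 𝟙 (P? x)
#≡∑ {zero}  P? = refl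
#≡∑ {suc n} P? with P? zero
... | yes _ = cong suc (#≡∑ (P? ∘ suc))
... | no  _ = #≡∑ (P? ∘ suc)

#-empty : {P : Pred (Fin n) 0ℓ} (P? : Decidable P) → (∀ x → ¬ P x) → # P? ≤ 0
#-empty P? ¬P = ≮⇒≥ λ 0<# → let x , p = #-nonempty P? 0<# in ¬P x p

∑-mono : {f g : Fin n → ℕ} → (∀ i → f i ≤ g i) → sum f ≤ sum g
∑-mono {zero}  f≤g = z≤n
∑-mono {suc n} f≤g = +-mono-≤ (f≤g zero) (∑-mono (f≤g ∘ suc))

∑-const : ∀ n c → ∑[ _ < n ] c ≡ n * c
∑-const zero    c = refl
∑-const (suc n) c = cong (c +_) (∑-const n c)

term≤∑ : (f : Fin n → ℕ) → ∀ i → f i ≤ sum f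
term≤∑ f zero    = m≤m+n _ _
term≤∑ f (suc i) = ≤-trans (term≤∑ (f ∘ suc) i) (m≤n+m _ _)

∑-indicator : ∀ (y : Fin n) → ∑[ x < n ] 𝟙 (x Fin.≟ y) ≤ 1
∑-indicator y = begin
  ∑[ x < _ ] 𝟙 (x Fin.≟ y)     ≡⟨ #≡∑ (Fin._≟ y) ⟨
  # (Fin._≟ y)                 ≤⟨ #-∖ (Fin._≟ y) y ⟩
  suc (# ((Fin._≟ y) ∖ y))     ≤⟨ s≤s (#-empty ((Fin._≟ y) ∖ y) λ _ (x≡y , x≢y) → x≢y x≡y) ⟩
  1                            ∎
  where open ≤-Reasoning

module Pruning {d N : ℕ} (σ : Fin d → Fin N → Fin N) (σ-involutive : ∀ i v → σ i (σ i v) ≡ v) where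

  -- Edges are counted by their ends: the pair of `v` and `i` is the end at `v` of the edge to
  -- `σ i v`, and `edge-σ` makes its opposite end belong as well.
  record IsEdgeSet (X : Fin N → Fin d → Set) : Set where
    field
      edge? : ∀ v i → Dec (X v i)
      edge-σ : ∀ {v i} → X v i → X (σ i v) i

  module _ {X : Fin N → Fin d → Set} (X-edges : IsEdgeSet X) where
    open IsEdgeSet X-edges

    module _ {U : Pred (Fin N) 0ℓ} (U? : Decidable U) where

      inside? : ∀ v → Decidable (λ i → X v i × U (σ i v))
      inside? v i = edge? v i ×-dec U? (σ i v)

      -- The sum over `U` of the degrees within `U`. Comparing it with `c * # U?` states that the
      -- average degree exceeds `c` without a division.
      edgeEnds : ℕ
      edgeEnds = ∑[ v < N ] # (λ i → U? v ×-dec inside? v i)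

    -- Deleting x loses its own edge ends and, by symmetry, as many opposite ones.
    edgeEnds-∖ : {U : Pred (Fin N) 0ℓ} (U? : Decidable U) → ∀ x →
                 edgeEnds U? ≤ edgeEnds (U? ∖ x) + 2 * # (inside? U? x)
    edgeEnds-∖ {U} U? x = begin
      ∑[ v < N ] # (λ i → U? v ×-dec inside? U? v i)
        ≤⟨ ∑-mono row ⟩
      ∑[ v < N ] (# (λ i → U′? v ×-dec inside? U′? v i) + ∑[ i < d ] (at x v i + at (σ i x) v i))
        ≡⟨ ∑-distrib-+ _ (λ v → ∑[ i < d ] (at x v i + at (σ i x) v i)) ⟩
      edgeEnds U′? + ∑[ v < N ] ∑[ i < d ] (at x v i + at (σ i x) v i)
        ≡⟨ cong (edgeEnds U′? +_) (trans
             (sum-cong-≗ (λ v → ∑-distrib-+ (at x v) (λ i → at (σ i x) v i)))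
             (∑-distrib-+ (λ v → ∑[ i < d ] at x v i) (λ v → ∑[ i < d ] at (σ i x) v i))) ⟩
      edgeEnds U′? + (∑[ v < N ] ∑[ i < d ] at x v i + ∑[ v < N ] ∑[ i < d ] at (σ i x) v i)
        ≤⟨ +-monoʳ-≤ (edgeEnds U′?) (+-mono-≤ (total (λ _ → x)) (total (λ i → σ i x))) ⟩
      edgeEnds U′? + (# (inside? U? x) + # (inside? U? x))
        ≡⟨ cong (λ m → edgeEnds U′? + (# (inside? U? x) + m)) (+-identityʳ _) ⟨
      edgeEnds U′? + 2 * # (inside? U? x) ∎
      where
      open ≤-Reasoning
      U′? = U? ∖ x

      at : Fin N → Fin N → Fin d → ℕ
      at y v i = 𝟙 (v Fin.≟ y) * 𝟙 (inside? U? x i)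

      total : ∀ (y : Fin d → Fin N) → ∑[ v < N ] ∑[ i < d ] at (y i) v i ≤ # (inside? U? x)
      total y = begin
        ∑[ v < N ] ∑[ i < d ] at (y i) v i   ≡⟨ ∑-comm (λ v i → at (y i) v i) ⟩
        ∑[ i < d ] ∑[ v < N ] at (y i) v i
          ≤⟨ ∑-mono (λ i → ≤-trans
               (≤-reflexive (sym (*-distribʳ-sum (𝟙 (inside? U? x i)) (λ v → 𝟙 (v Fin.≟ y i)))))
               (≤-trans (*-monoˡ-≤ (𝟙 (inside? U? x i)) (∑-indicator (y i))) (≤-reflexive (*-identityˡ _)))) ⟩
        ∑[ i < d ] 𝟙 (inside? U? x i)        ≡⟨ #≡∑ (inside? U? x) ⟨
        # (inside? U? x)                     ∎

      cell : ∀ v i → 𝟙 (U? v ×-dec inside? U? v i) ≤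
             𝟙 (U′? v ×-dec inside? U′? v i) + (at x v i + at (σ i x) v i)
      cell v i = 𝟙≤ (U? v ×-dec inside? U? v i) λ (u , χ , u′) →
        bound u χ u′ (v Fin.≟ x) (σ i v Fin.≟ x)
        where
        kept : ℕ
        kept = 𝟙 (U′? v ×-dec inside? U′? v i)
        bound : U v → X v i → U (σ i v) → Dec (v ≡ x) → Dec (σ i v ≡ x) →
                1 ≤ kept + (at x v i + at (σ i x) v i)
        bound u χ u′ (yes refl) _ =
          m≤n⇒m≤o+n kept (m≤n⇒m≤n+o (at (σ i x) x i) (*-mono-≤ (≤𝟙 (v Fin.≟ v) refl) (≤𝟙 (inside? U? v i) (χ , u′))))
        -- The end opposite to one at the deleted vertex: that vertex is `σ i v`, so `v` is its
        -- image under `σ i`.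
        bound u χ u′ (no _) (yes refl) =
          m≤n⇒m≤o+n kept (m≤n⇒m≤o+n (at (σ i v) v i) (*-mono-≤
            (≤𝟙 (v Fin.≟ σ i (σ i v)) (sym (σ-involutive i v)))
            (≤𝟙 (inside? U? (σ i v) i) (edge-σ χ , subst U (sym (σ-involutive i v)) u))))
        bound u χ u′ (no v≢x) (no σv≢x) =
          m≤n⇒m≤n+o _ (≤𝟙 (U′? v ×-dec inside? U′? v i) ((u , v≢x) , χ , u′ , σv≢x))

      row : ∀ v → # (λ i → U? v ×-dec inside? U? v i) ≤
            # (λ i → U′? v ×-dec inside? U′? v i) + ∑[ i < d ] (at x v i + at (σ i x) v i)
      row v = begin
        # (λ i → U? v ×-dec inside? U? v i)   ≡⟨ #≡∑ (λ i → U? v ×-dec inside? U? v i) ⟩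
        ∑[ i < d ] 𝟙 (U? v ×-dec inside? U? v i) ≤⟨ ∑-mono (cell v) ⟩
        ∑[ i < d ] (𝟙 (U′? v ×-dec inside? U′? v i) + (at x v i + at (σ i x) v i))
          ≡⟨ ∑-distrib-+ (λ i → 𝟙 (U′? v ×-dec inside? U′? v i)) (λ i → at x v i + at (σ i x) v i) ⟩
        ∑[ i < d ] 𝟙 (U′? v ×-dec inside? U′? v i) + ∑[ i < d ] (at x v i + at (σ i x) v i)
          ≡⟨ cong (_+ ∑[ i < d ] (at x v i + at (σ i x) v i)) (#≡∑ (λ i → U′? v ×-dec inside? U′? v i)) ⟨
        # (λ i → U′? v ×-dec inside? U′? v i) + ∑[ i < d ] (at x v i + at (σ i x) v i) ∎

    edgeEnds-≤ : {U : Pred (Fin N) 0ℓ} (U? : Decidable U) → ∀ {c} →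
                 (∀ {v} → U v → # (inside? U? v) ≤ c) → edgeEnds U? ≤ c * # U?
    edgeEnds-≤ U? {c} ≤c = begin
      edgeEnds U?                  ≤⟨ ∑-mono row ⟩
      ∑[ v < N ] (c * 𝟙 (U? v))    ≡⟨ *-distribˡ-sum c (𝟙 ∘ U?) ⟨
      c * ∑[ v < N ] 𝟙 (U? v)      ≡⟨ cong (c *_) (#≡∑ U?) ⟨
      c * # U?                     ∎
      where
      open ≤-Reasoning
      row : ∀ v → # (λ i → U? v ×-dec inside? U? v i) ≤ c * 𝟙 (U? v)
      row v = bound (U? v)
        where
        bound : (u? : Dec _) → # (λ i → u? ×-dec inside? U? v i) ≤ c * 𝟙 u?
        bound (yes u) = begin
          # (λ i → yes u ×-dec inside? U? v i) ≤⟨ #-mono (λ i → yes u ×-dec inside? U? v i) (inside? U? v) proj₂ ⟩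
          # (inside? U? v)                     ≤⟨ ≤c u ⟩
          c                                    ≡⟨ *-identityʳ c ⟨
          c * 1                                ∎
        bound (no ¬u) = ≤-trans (#-empty (λ i → no ¬u ×-dec inside? U? v i) λ _ (u , _) → ¬u u) z≤n

    -- For `c = k - 1`, `degree-≥` provides the degree `⌈ k /2⌉` needed for an ordinary vertex of
    -- the tree, and `centre-≥` the degree `k` needed for its root.
    record Core (U : Pred (Fin N) 0ℓ) (c : ℕ) : Set₁ where
      field
        {Member}  : Pred (Fin N) 0ℓ
        member?   : Decidable Member
        member⇒   : ∀ {v} → Member v → U v
        degree-≥  : ∀ {v} → Member v → c < 2 * # (inside? member? v)
        centre    : Fin N
        centre∈   : Member centre
        centre-≥  : c < # (inside? member? centre)

    -- Deleting a vertex of degree at most `c / 2` costs at most `c` edge ends, so the strict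
    -- density bound survives. Once no such vertex is left, the bound still forces a degree above
    -- `c`.
    core : ∀ {c} fuel {U : Pred (Fin N) 0ℓ} (U? : Decidable U) → # U? < fuel →
           c * # U? < edgeEnds U? → Core U c
    core (suc fuel) U? (s≤s #≤fuel) dense
      with Fin.any? (λ x → U? x ×-dec 2 * # (inside? U? x) ≤? _)
    core {c} (suc fuel) U? (s≤s #≤fuel) dense | yes (x , ux , light) =
      record { Core smaller ; member⇒ = proj₁ ∘ Core.member⇒ smaller }
      where
      open ≤-Reasoning
      U′? = U? ∖ x
      shrinks : # U′? < # U?
      shrinks = #-mono-< U′? U? proj₁ ux λ (_ , x≢x) → x≢x refl
      dense′ : c * # U′? < edgeEnds U′?
      dense′ = +-cancelʳ-< c _ _ (begin-strict
        c * # U′? + c                        ≡⟨ +-comm (c * # U′?) c ⟩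
        c + c * # U′?                        ≡⟨ *-suc c (# U′?) ⟨
        c * suc (# U′?)                      ≤⟨ *-monoʳ-≤ c shrinks ⟩
        c * # U?                             <⟨ dense ⟩
        edgeEnds U?                          ≤⟨ edgeEnds-∖ U? x ⟩
        edgeEnds U′? + 2 * # (inside? U? x)  ≤⟨ +-monoʳ-≤ (edgeEnds U′?) light ⟩
        edgeEnds U′? + c                     ∎)
      smaller = core fuel U′? (<-≤-trans shrinks #≤fuel) dense′
    core {c} (suc fuel) U? (s≤s #≤fuel) dense | no ¬light
      with Fin.any? (λ x → U? x ×-dec c <? # (inside? U? x))
    ... | yes (x , ux , heavy) = record
      { member? = U? ; member⇒ = id ; degree-≥ = λ u → ≰⇒> λ light → ¬light (_ , u , light)
      ; centre = x ; centre∈ = ux ; centre-≥ = heavy }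
    ... | no ¬heavy = contradiction dense
      (≤⇒≯ (edgeEnds-≤ U? λ u → ≮⇒≥ λ heavy → ¬heavy (_ , u , heavy)))

  module _ {s} (colour : Fin N → Fin d → Fin s) (colour-σ : ∀ v i → colour (σ i v) i ≡ colour v i) where

    colourClass : ∀ j → IsEdgeSet (λ v i → colour v i ≡ j)
    colourClass j = record
      { edge?  = λ v i → colour v i Fin.≟ j
      ; edge-σ = λ {v} {i} eq → trans (colour-σ v i) eq }

    -- Since `U` is closed under every `σ i`, each of the `d` edge ends at a vertex of `U` is
    -- counted in the class of its colour.
    ∑-edgeEnds : {U : Pred (Fin N) 0ℓ} (U? : Decidable U) → (∀ i {v} → U v → U (σ i v)) →
                 d * # U? ≤ ∑[ j < s ] edgeEnds (colourClass j) U?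
    ∑-edgeEnds {U} U? U-σ = begin
      d * # U?                                  ≡⟨ cong (d *_) (#≡∑ U?) ⟩
      d * ∑[ v < N ] 𝟙 (U? v)                   ≡⟨ *-distribˡ-sum d (𝟙 ∘ U?) ⟩
      ∑[ v < N ] (d * 𝟙 (U? v))                 ≤⟨ ∑-mono rows ⟩
      ∑[ v < N ] ∑[ j < s ] # (row v j)         ≡⟨ ∑-comm (λ v j → # (row v j)) ⟩
      ∑[ j < s ] ∑[ v < N ] # (row v j)         ∎
      where
      open ≤-Reasoning
      row : ∀ v j → Decidable (λ i → U v × colour v i ≡ j × U (σ i v))
      row v j i = U? v ×-dec inside? (colourClass j) U? v i

      rows : ∀ v → d * 𝟙 (U? v) ≤ ∑[ j < s ] # (row v j)
      rows v = begin
        d * 𝟙 (U? v)                          ≡⟨ ∑-const d (𝟙 (U? v)) ⟨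
        ∑[ i < d ] 𝟙 (U? v)                   ≤⟨ ∑-mono (λ i → 𝟙≤ (U? v) λ u → ≤-trans
          (≤𝟙 (row v (colour v i) i) (u , refl , U-σ i u))
          (term≤∑ (λ j → 𝟙 (row v j i)) (colour v i))) ⟩
        ∑[ i < d ] ∑[ j < s ] 𝟙 (row v j i)   ≡⟨ ∑-comm (λ i j → 𝟙 (row v j i)) ⟩
        ∑[ j < s ] ∑[ i < d ] 𝟙 (row v j i)   ≡⟨ sum-cong-≗ (λ j → #≡∑ (row v j)) ⟨
        ∑[ j < s ] # (row v j)                ∎

    -- Averaging over the colours: if no class were dense, then `d * # U?` would be at most
    -- `s * c * # U?`, which fails because `U` is nonempty.
    dense-colour : {U : Pred (Fin N) 0ℓ} (U? : Decidable U) → (∀ i {v} → U v → U (σ i v)) →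
                   ∃ U → ∀ {c} → s * c < d →
                   ∃ λ j → c * # U? < edgeEnds (colourClass j) U?
    dense-colour U? U-σ (v , u) {c} sc<d with Fin.any? (λ j → c * # U? <? edgeEnds (colourClass j) U?)
    ... | yes dense = dense
    ... | no ¬dense = contradiction (≤-trans (∑-edgeEnds U? U-σ) sparse) (<⇒≱ (*-monoˡ-< (# U?) {{>-nonZero #>0}} sc<d))
      where
      open ≤-Reasoning
      #>0 : 0 < # U?
      #>0 = ≤-<-trans z≤n (#-mono-< (λ _ → no id) U? (λ ()) u id)
      sparse : ∑[ j < s ] edgeEnds (colourClass j) U? ≤ s * c * # U?
      sparse = begin
        ∑[ j < s ] edgeEnds (colourClass j) U? ≤⟨ ∑-mono (λ j → ≮⇒≥ λ dense → ¬dense (j , dense)) ⟩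
        ∑[ j < s ] (c * # U?)                  ≡⟨ ∑-const s (c * # U?) ⟩
        s * (c * # U?)                         ≡⟨ *-assoc s c (# U?) ⟨
        s * c * # U?                           ∎

⌈/2⌉≤ : ∀ {n m} → n ≤ 2 * m → ⌈ n /2⌉ ≤ m
⌈/2⌉≤ {n} {m} n≤2m = begin
  ⌈ n /2⌉        ≤⟨ ⌈n/2⌉-mono n≤2m ⟩
  ⌈ 2 * m /2⌉    ≡⟨ cong (λ l → ⌈ m + l /2⌉) (+-identityʳ m) ⟩
  ⌈ m + m /2⌉    ≡⟨ n≡⌈n+n/2⌉ m ⟨
  m              ∎
  where open ≤-Reasoning

-- Upper bound: a monochromatic copy of the tree in the regular graph

module HighGirth {d R : ℕ} (G : RegularGraph d R) where
  open RegularGraph G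

  H : Graph
  H = record
    { order    = order
    ; _~_      = λ u v → ∃ λ i → σ i u ≡ v
    ; _~?_     = λ u v → Fin.any? λ i → σ i u Fin.≟ v
    ; ~-sym    = λ { {u} (i , refl) → i , σ-involutive i u }
    ; ~-irrefl = λ { {u} refl (i , eq) → Bool.not-¬ refl (trans (cong side (sym eq)) (side-σ i u)) }
    }

  open Graph H using (_~_; _~?_; ~-sym)

  bipartite : Bipartite H
  bipartite = side , λ { {u} (i , refl) eq → Bool.not-¬ refl (trans eq (side-σ i u)) }

  degree≤d : ∀ v → degree H v ≤ d
  degree≤d v = ≮⇒≥ λ d<deg →
    let w , (i , eq) , ¬eq = pigeonhole (everything d) (v ~?_) (λ i w → σ i v Fin.≟ w)
          (λ p q → trans (sym p) q) _ (≤-<-trans (≤-reflexive (#-everything d)) d<deg)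
    in ¬eq i eq

  -- The neighbours of a good vertex along the `d` letters carry distinct one-letter labels, so no
  -- two of them coincide.
  d≤degree : 0 < R → ∀ {v} → Good v → d ≤ degree H v
  d≤degree 0<R {v} good = ≮⇒≥ λ deg<d →
    let i , _ , ¬eq = pigeonhole (v ~?_) (everything d) (λ w i → σ i v Fin.≟ w)
          (λ {w} {i} {j} p q → ∷-injectiveˡ (trans (sym (label-σ i)) (trans (cong label (trans p (sym q))) (label-σ j))))
          (λ {w} {i} eq → i , eq) (<-≤-trans deg<d (≤-reflexive (sym (#-everything d))))
    in ¬eq (σ i v) refl
    where
    label = proj₁ (unfold good)
    label-v = proj₁ (proj₂ (unfold good))

    label-σ : ∀ i → label (σ i v) ≡ i ∷ []
    label-σ i = trans
      (proj₂ (proj₂ (unfold good)) i v (subst (λ w → length w < R) (sym label-v) 0<R)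
        (subst (λ w → head w ≢ _) (sym label-v) λ ()))
      (cong (i ∷_) label-v)

  Δ≡d : 0 < R → Δ H ≡ d
  Δ≡d 0<R = ≤-antisym (Δ≤ H degree≤d)
    (≤-trans (d≤degree 0<R (proj₂ origin)) (degree≤Δ H (proj₁ origin)))

  module _ {s} (κ : EdgeColouring H s) where
    open EdgeColouring κ

    -- Both proofs are compared with the same proof of the reversed adjacency. Different letters can
    -- witness one adjacency, so this is needed to read colours off letters.
    colour-irrelevant : ∀ {u v} (e e′ : u ~ v) → colour e ≡ colour e′
    colour-irrelevant e e′ =
      trans (colour-unordered e (~-sym e)) (sym (colour-unordered e′ (~-sym e)))

    letterColour : Fin order → Fin d → Fin s
    letterColour v i = colour {v} (i , refl)

    colour≡letterColour : ∀ {u v i} (eq : σ i u ≡ v) → colour (i , eq) ≡ letterColour u i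
    colour≡letterColour refl = refl

    letterColour-σ : ∀ v i → letterColour (σ i v) i ≡ letterColour v i
    letterColour-σ v i = trans (sym (colour≡letterColour (σ-involutive i v)))
      (colour-unordered (i , σ-involutive i v) (i , refl))

  open Pruning σ σ-involutive

  module _ {T : Graph} (tree : IsTree T) {r : Vertex T} {c s : ℕ}
           (degree-r : degree T r ≡ suc c)
           (degree-≢r : ∀ v → v ≢ r → degree T v ≤ ⌈ suc c /2⌉)
           (order≤R : Graph.order T ≤ R) (κ : EdgeColouring H s) where
    open EdgeColouring κ using (colour; colour-unordered)
    open Graph T using () renaming (_~_ to _~ᵀ_; ~-sym to ~ᵀ-sym)

    module _ {j : Fin s} (K : Core (colourClass (letterColour κ) (letterColour-σ κ) j) Good c) where
      open Core K

      good : Good centre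
      good = member⇒ centre∈

      label : Fin order → Word d
      label = proj₁ (unfold good)

      follow : Word d → Fin order
      follow []      = centre
      follow (i ∷ w) = σ i (follow w)

      open WordEmbedding T tree r
        (inside? (colourClass (letterColour κ) (letterColour-σ κ) j) member? ∘ follow)

      follow∈ : ∀ {w} → Valid w → Member (follow w)
      follow∈ []                    = centre∈
      follow∈ (((_ , m) , _) ∷ _) = m

      -- The label recovers the word that was followed, so distinct reduced words of length at most
      -- `R` end at distinct vertices. Injectivity of the embedding rests on this.
      label-follow : ∀ {w} → Valid w → length w ≤ R → label (follow w) ≡ w
      label-follow []                          _   = proj₁ (proj₂ (unfold good))
      label-follow {i ∷ w} ((_ , head≢) ∷ valid) i∷w≤R =
        trans (proj₂ (proj₂ (unfold good)) i (follow w)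
                 (subst (λ u → length u < R) (sym ih) i∷w≤R)
                 (subst (λ u → head u ≢ just i) (sym ih) head≢))
              (cong (i ∷_) ih)
        where
        ih : label (follow w) ≡ w
        ih = label-follow valid (<⇒≤ i∷w≤R)

      T-embedding : Embedding
      T-embedding = embedding enough
        where
        enough : ∀ x {w} → Valid w → (x ≡ r → w ≡ []) → degree T x ≤ _
        enough x valid at-r with x Fin.≟ r
        -- The root sits at the empty word, which `follow` sends to the centre.
        ... | yes refl with refl ← at-r refl = ≤-trans (≤-reflexive degree-r) centre-≥
        ... | no x≢r   = ≤-trans (degree-≢r x x≢r) (⌈/2⌉≤ (degree-≥ (follow∈ valid)))

      open Embedding T-embedding

      φ : Vertex T → Vertex H
      φ = follow ∘ ω

      label-φ : ∀ x → label (φ x) ≡ ω x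
      label-φ x = label-follow (ω-valid x) (≤-trans (ω-length x) order≤R)

      φ-injective : ∀ {x y} → φ x ≡ φ y → x ≡ y
      φ-injective {x} {y} eq =
        ω-injective (trans (sym (label-φ x)) (trans (cong label eq) (label-φ y)))

      child⇒edge : ∀ {x y} → Child (ω x) (ω y) →
                   ∃ λ i → σ i (φ x) ≡ φ y × letterColour κ (φ x) i ≡ j
      child⇒edge {x} {y} (i , eq) = i , sym (cong follow eq) , colour-j (subst Valid eq (ω-valid y))
        where
        colour-j : Valid (i ∷ ω x) → letterColour κ (φ x) i ≡ j
        colour-j (((≡j , _) , _) ∷ _) = ≡j

      φ-edge : ∀ {x y} → x ~ᵀ y → φ x ~ φ y
      φ-edge x~y with ω-edge x~y
      ... | inj₁ child with i , eq , _ ← child⇒edge child = i , eq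
      ... | inj₂ child with i , eq , _ ← child⇒edge child = ~-sym (i , eq)

      φ-colour : ∀ {x y} → x ~ᵀ y → (e : φ x ~ φ y) → colour e ≡ j
      φ-colour x~y e with ω-edge x~y
      ... | inj₁ child with i , eq , ≡j ← child⇒edge child =
        trans (colour-irrelevant κ e (i , eq)) (trans (colour≡letterColour κ eq) ≡j)
      ... | inj₂ child with i , eq , ≡j ← child⇒edge child =
        trans (colour-unordered e (i , eq)) (trans (colour≡letterColour κ eq) ≡j)

      image : Subgraph H
      image = record
        { V     = λ v → ∃ λ x → φ x ≡ v
        ; E     = λ u v → ∃₂ λ x y → x ~ᵀ y × φ x ≡ u × φ y ≡ v
        ; E-sym = λ (x , y , x~y , p , q) → y , x , ~ᵀ-sym x~y , q , p
        ; E⇒~   = λ { (_ , _ , x~y , refl , refl) → φ-edge x~y }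
        ; E⇒V   = λ (x , _ , _ , p , _) → x , p
        }

      image-monochromatic : Monochromatic κ image
      image-monochromatic = j , λ { (_ , _ , x~y , refl , refl) → φ-colour x~y (φ-edge x~y) }

      T≅image : T ≅ image
      T≅image = record
        { to         = φ
        ; injective  = φ-injective
        ; to-∈       = λ x → x , refl
        ; surjective = id
        ; adjacency  = λ x y → mk⇔ (λ x~y → x , y , x~y , refl , refl)
            λ (_ , _ , x~y , p , q) → subst₂ _~ᵀ_ (φ-injective p) (φ-injective q) x~y
        }

    monochromatic-copy : s * c < d → Σ[ S ∈ Subgraph H ] (Monochromatic κ S × T ≅ S)
    monochromatic-copy sc<d
      with j , dense ← dense-colour (letterColour κ) (letterColour-σ κ) good? good-σ origin {c} sc<d =
      image K , image-monochromatic K , T≅image K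
      -- `≤-refl` fixes the fuel at one more than the number of good vertices.
      where K = core _ _ good? ≤-refl dense

theorem1 : (s k : ℕ) → 1 ≤ s → 2 ≤ k →
    (T : Graph) → IsTree T →
    (r : Vertex T) → degree T r ≡ k →
    (∀ v → v ≢ r → degree T v ≤ ⌈ k /2⌉) →
    IsDegreeBipartiteRamseyNumber T s (s * (k ∸ 1) + 1)
theorem1 s zero    _ () T tree r degree-r degree-≢r
theorem1 s (suc c) _ _  T tree r degree-r degree-≢r =
    (H , bipartite , (λ κ → monochromatic-copy tree degree-r degree-≢r ≤-refl κ sc<d) , Δ≡d R>0)
  , λ (H′ , bipartite′ , H′⟶T , Δ≡) → begin
      s * c + 1    ≡⟨ +-comm (s * c) 1 ⟩
      suc (s * c)  ≤⟨ arrowing⇒large-Δ bipartite′ H′⟶T r (≤-reflexive (sym degree-r)) ⟩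
      Δ H′         ≡⟨ Δ≡ ⟩
      _            ∎
  where
  open ≤-Reasoning
  R>0 : 0 < Graph.order T
  R>0 = ≤-<-trans z≤n (Fin.toℕ<n r)
  sc<d : s * c < s * c + 1
  sc<d = ≤-reflexive (+-comm 1 (s * c))
  -- The order of `T` is a sufficient radius, since by `ω-length` no word used in the embedding is
  -- longer.
  open HighGirth (regularGraph (s * c + 1) (Graph.order T))
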